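{- For all integers $d\geq 2$ and $\Delta\geq 2$, there exists a connected bipartite graph $G$ with $\mathrm{diam}(G)=d$ and $\Delta(G)=\Delta$ such that $G$ admits an interval edge coloring (i.e. $G\in\mathfrak{N}$) and $W(G)=d(\Delta-1)+1$.
   Context: All graphs are finite, undirected, without loops or multiple edges. $\Delta(G)$ denotes the maximum degree of $G$ and $\mathrm{diam}(G)$ its diameter. For a positive integer $t$, an interval $t$-coloring of a graph $G$ is a map assigning to each edge of $G$ a color from $\{1,2,\ldots,t\}$ such that every color $i\in\{1,\ldots,t\}$ is used on at least one edge, edges sharing a vertex receive distinct colors, and for each vertex $v$ the set of colors of edges incident to $v$ is an interval of consecutive integers. $\mathfrak{N}$ denotes the set of graphs that admit an interval $t$-coloring for some $t$, and for $G\in\mathfrak{N}$, $W(G)$ denotes the greatest $t$ for which $G$ has an interval $t$-coloring. -}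

module Defs where

open import Data.Bool.Base using (Bool)
open import Data.Fin.Base using (Fin)
open import Data.List.Base using (allFin; filter; length; map)
open import Data.List.Extrema.Nat using (max)
open import Data.Nat.Base using (ℕ; zero; suc; _≤_; _<_)
open import Data.Product.Base using (_×_; ∃; ∃-syntax; ∃₂)
open import Function.Bundles using (_⇔_)
open import Relation.Binary.Construct.Closure.ReflexiveTransitive using (Star; ε; _◅_)
open import Relation.Binary.PropositionalEquality using (_≡_; _≢_)
open import Relation.Binary.Core using (Rel)
open import Relation.Binary.Definitions using (Symmetric; Irreflexive; Decidable)
open import Relation.Unary using (Pred)
open import Level using (0ℓ)

record Graph : Set₁ where
  infix 4 _~_ _~?_
  field
    order    : ℕ
  Vertex : Set
  Vertex = Fin order
  field
    _~_      : Rel Vertex 0ℓ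
    _~?_     : Decidable _~_
    ~-sym    : Symmetric _~_
    ~-irrefl : Irreflexive _≡_ _~_

Least Greatest : Pred ℕ 0ℓ → Pred ℕ 0ℓ
Least    P n = P n × (∀ m → P m → n ≤ m)
Greatest P n = P n × (∀ m → P m → m ≤ n)

-- S = {a, a+1, …, b}; the empty set is included (a > b), so that isolated
-- vertices impose no condition on a coloring.
IsInterval : Pred ℕ 0ℓ → Set
IsInterval S = ∃₂ λ a b → ∀ i → S i ⇔ (a ≤ i × i ≤ b)

module _ (G : Graph) where
  open Graph G

  Walk : Rel Vertex 0ℓ
  Walk = Star _~_

  walkLength : ∀ {u v} → Walk u v → ℕ
  walkLength ε       = zero
  walkLength (_ ◅ w) = suc (walkLength w)

  Connected : Set
  Connected = ∀ u v → Walk u v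

  Bipartite : Set
  Bipartite = ∃ λ (side : Vertex → Bool) → ∀ {u v} → u ~ v → side u ≢ side v

  degree : Vertex → ℕ
  degree v = length (filter (v ~?_) (allFin order))

  maxDegree : ℕ
  maxDegree = max 0 (map degree (allFin order))

  -- A walk of least length repeats no vertex, so this is the length of a
  -- shortest path.
  Distance : Vertex → Vertex → Pred ℕ 0ℓ
  Distance u v = Least λ k → ∃[ w ] walkLength {u} {v} w ≡ k

  -- Pairs without a distance are ignored, so this is the diameter only for
  -- connected graphs.
  Diameter : Pred ℕ 0ℓ
  Diameter = Greatest λ k → ∃₂ λ u v → Distance u v k

  -- An edge {u , v} is given by either of its orientations; values of colour
  -- at non-adjacent pairs are unconstrained and never used.
  record IntervalColoring (t : ℕ) : Set where
    field
      positive   : 0 < t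
      colour     : Vertex → Vertex → ℕ
      colour-sym : ∀ {u v} → u ~ v → colour u v ≡ colour v u
      colour-≥1  : ∀ {u v} → u ~ v → 1 ≤ colour u v
      colour-≤t  : ∀ {u v} → u ~ v → colour u v ≤ t
      all-used   : ∀ i → 1 ≤ i → i ≤ t → ∃₂ λ u v → u ~ v × colour u v ≡ i
      proper     : ∀ {u v w} → u ~ v → u ~ w → v ≢ w → colour u v ≢ colour u w
      interval   : ∀ u → IsInterval λ i → ∃[ v ] (u ~ v × colour u v ≡ i)

  -- Membership in 𝔑.
  IntervalColorable : Set
  IntervalColorable = ∃[ t ] IntervalColoring t

  -- W(G) = t.
  MaxIntervalSpan : Pred ℕ 0ℓ
  MaxIntervalSpan = Greatest IntervalColoring

{-# OPTIONS --safe #-}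
module Submission where

-- Write d = k + 1, Δ = n + 1 and M = k n.  The graph has two copies of the positions
-- 0 … M as its sides; the edges of (0-based) colour c join i to j across the sides by
-- reflecting the interval [c − n , c] ∩ [0 , M].  Position i then sees exactly the colours
-- i … i + n, so the graph is Δ-regular and interval coloured with M + n + 1 colours.
-- An edge moves the position by at most n, so 0 and M need k steps, and k + 1 if they
-- lie on the wrong sides.  Conversely an edge amounts to n unit steps on a cycle of length
-- 2 (M + 1), in which walks of M unit steps lead from any position to any other.
-- No interval colouring of any bipartite graph of diameter d and maximum degree Δ does
-- better: two edges are joined through a walk of length less than d, and the colour
-- grows by at most n at each of its vertices.

open import Data.Bool.Base using (Bool; false; not)
open import Data.Bool.Properties using (¬-not; not-¬) renaming (_≟_ to _≟ᵇ_)
open import Data.Fin.Base using (Fin; zero; suc; toℕ; fromℕ<; combine; remQuot)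
open import Data.Fin.Properties
  using (toℕ<n; toℕ-injective; toℕ≤pred[n]; toℕ-fromℕ<; fromℕ<-injective; injective⇒≤; 2↔Bool; remQuot-combine; combine-remQuot)
open import Data.List.Base using (List; []; _∷_; allFin; filter; lookup; map)
open import Data.List.Extrema.Nat using (max≤v⁺; v≤max⁺)
open import Data.List.Membership.Propositional using (_∈_; lose)
open import Data.List.Membership.Propositional.Properties
  using (∈-filter⁺; ∈-filter⁻; ∈-allFin; ∈-lookup)
open import Data.List.Membership.Setoid.Properties using (index-injective)
open import Data.List.Relation.Unary.All as All using ()
open import Data.List.Relation.Unary.All.Properties as All using ()
open import Data.List.Relation.Unary.AllPairs using (_∷_)
open import Data.List.Relation.Unary.Any.Properties as Any using ()
open import Data.List.Relation.Unary.Unique.Propositional using (Unique)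
open import Data.List.Relation.Unary.Unique.Propositional.Properties using (filter⁺; allFin⁺)
open import Data.Nat.Base
open import Data.Nat.GeneralisedArithmetic using (iterate)
open import Data.Nat.Properties
open import Data.Nat.Tactic.RingSolver using (solve)
open import Data.Product.Base using (_×_; _,_; proj₁; proj₂; uncurry; ∃-syntax; ∃₂)
open import Data.Sum.Base using (_⊎_; inj₁; inj₂)
open import Function.Base using (_∘_)
open import Function.Bundles using (Inverse; Injection; Equivalence; mk⇔)
open import Function.Properties.Inverse using (↔⇒↣)
open import Function.Definitions using (Injective)
open import Relation.Binary.Construct.Closure.ReflexiveTransitive using (ε; _◅_)
open import Relation.Binary.Definitions using (tri<; tri≈; tri>)
open import Relation.Binary.PropositionalEquality
open import Relation.Nullary using (Dec; yes; no; contradiction; map′; _×-dec_; ¬?)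
open import Algebra.Properties.CommutativeSemigroup +-commutativeSemigroup using (xy∙z≈xz∙y)
open import Defs

-- Duplicate-free lists and iterated negation.

lookup-injective : ∀ {A : Set} {xs : List A} → Unique xs → Injective _≡_ _≡_ (lookup xs)
lookup-injective (_    ∷ _)  {zero}  {zero}  _  = refl
lookup-injective (x≢xs ∷ _)  {zero}  {suc j} eq = contradiction eq (All.lookup x≢xs (∈-lookup j))
lookup-injective (x≢xs ∷ _)  {suc i} {zero}  eq = contradiction (sym eq) (All.lookup x≢xs (∈-lookup i))
lookup-injective (_    ∷ xs) {suc i} {suc j} eq = cong suc (lookup-injective xs eq)

iterate-not-suc : ∀ k b → iterate not b (suc k) ≡ not (iterate not b k)
iterate-not-suc zero    b = refl
iterate-not-suc (suc k) b = iterate-not-suc k (not b)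

-- Degrees, walks and the upper bound for interval colourings.

module _ (G : Graph) where
  open Graph G

  injective⇒≤degree : ∀ {k u} (f : Fin k → Vertex) → (∀ i → u ~ f i) →
                      Injective _≡_ _≡_ f → k ≤ degree G u
  injective⇒≤degree {u = u} f u~f f-inj =
    injective⇒≤ (f-inj ∘ index-injective (setoid Vertex) (f∈ _) (f∈ _))
    where
    f∈ : ∀ i → f i ∈ filter (u ~?_) (allFin order)
    f∈ i = ∈-filter⁺ (u ~?_) (∈-allFin (f i)) (u~f i)

  injective⇒degree≤ : ∀ {k u} (f : ∀ v → u ~ v → Fin k) →
                      (∀ {v w} (p : u ~ v) (q : u ~ w) → f v p ≡ f w q → v ≡ w) →
                      degree G u ≤ k
  injective⇒degree≤ {u = u} f f-inj =
    injective⇒≤ (lookup-injective (filter⁺ (u ~?_) {allFin order} (allFin⁺ order)) ∘ f-inj (adj _) (adj _))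
    where
    adj : ∀ i → u ~ lookup (filter (u ~?_) (allFin order)) i
    adj i = proj₂ (∈-filter⁻ (u ~?_) {xs = allFin order} (∈-lookup i))

  regular⇒maxDegree : ∀ {Δ} → Vertex → (∀ v → degree G v ≡ Δ) → maxDegree G ≡ Δ
  regular⇒maxDegree u deg = ≤-antisym
    (max≤v⁺ {xs = map (degree G) (allFin order)} z≤n (All.map⁺ (All.tabulate {xs = allFin order} λ {v} _ → ≤-reflexive (deg v))))
    (v≤max⁺ 0 (map (degree G) (allFin order))
      (inj₂ (Any.map⁺ (lose (∈-allFin u) (≤-reflexive (sym (deg u)))))))

  ≡⇒walk : ∀ {u v} → u ≡ v → ∃[ w ] walkLength G {u} {v} w ≡ 0
  ≡⇒walk refl = ε , refl

  walk-side : ((side , _) : Bipartite G) → ∀ {u v} (w : Walk G u v) →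
              side v ≡ iterate not (side u) (walkLength G w)
  walk-side _             ε        = refl
  walk-side b@(side , alt) (u~x ◅ w) =
    trans (walk-side b w)
      (cong (λ s → iterate not s (walkLength G w)) (¬-not (alt u~x ∘ sym)))

  module _ {t} (C : IntervalColoring G t) where
    open IntervalColoring C

    -- A larger jump would put the `n + 2` consecutive colours from `colour u v` on into the
    -- interval at `u`. Each is carried by a neighbour of its own, which is too many for the degree.
    colour-jump : ∀ {u v w n} → degree G u ≤ suc n → u ~ v → u ~ w →
                  colour u w ≤ colour u v + n
    colour-jump {u} {v} {w} {n} deg≤ u~v u~w with interval u
    ... | a , b , spectrum = ≮⇒≥ λ jump →
      let
        inside : ∀ (i : Fin (2 + n)) → a ≤ colour u v + toℕ i × colour u v + toℕ i ≤ b
        inside i =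
            ≤-trans (proj₁ (Equivalence.to (spectrum _) (v , u~v , refl))) (m≤m+n _ _)
          , (begin
              colour u v + toℕ i    ≤⟨ +-monoʳ-≤ (colour u v) (s≤s⁻¹ (toℕ<n i)) ⟩
              colour u v + suc n    ≡⟨ +-suc _ n ⟩
              suc (colour u v + n)  ≤⟨ jump ⟩
              colour u w            ≤⟨ proj₂ (Equivalence.to (spectrum _) (w , u~w , refl)) ⟩
              b                     ∎)
        end : ∀ i → ∃[ x ] (u ~ x × colour u x ≡ colour u v + toℕ i)
        end i = Equivalence.from (spectrum _) (inside i)
      in 1+n≰n (≤-trans
        (injective⇒≤degree (proj₁ ∘ end) (proj₁ ∘ proj₂ ∘ end) λ {i} {j} eq →
          toℕ-injective (+-cancelˡ-≡ (colour u v) _ _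
            (trans (sym (proj₂ (proj₂ (end i))))
              (trans (cong (colour u) eq) (proj₂ (proj₂ (end j)))))))
        deg≤)
      where open ≤-Reasoning

    module _ {n} (deg≤ : ∀ v → degree G v ≤ suc n) where

      -- One `colour-jump` at every vertex of the walk. There is one vertex more than there are
      -- edges, hence `suc`; even `ε` costs a jump.
      colour-walk : ∀ {u v x y} (w : Walk G u v) → u ~ x → v ~ y →
                    colour v y ≤ colour u x + suc (walkLength G w) * n
      colour-walk {u} {x = x} ε u~x u~y =
        subst (λ m → _ ≤ colour u x + m) (sym (+-identityʳ n)) (colour-jump (deg≤ u) u~x u~y)
      colour-walk {u} {v} {x} {y} (_◅_ {j = z} u~z w) u~x v~y = begin
        colour v y                         ≤⟨ colour-walk w (~-sym u~z) v~y ⟩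
        colour z u + suc ℓ * n             ≡⟨ cong (_+ suc ℓ * n) (colour-sym (~-sym u~z)) ⟩
        colour u z + suc ℓ * n             ≤⟨ +-monoˡ-≤ (suc ℓ * n) (colour-jump (deg≤ u) u~x u~z) ⟩
        colour u x + n + suc ℓ * n         ≡⟨ +-assoc (colour u x) n (suc ℓ * n) ⟩
        colour u x + (n + suc ℓ * n)       ∎
        where open ≤-Reasoning; ℓ = walkLength G w

      colour-span : ∀ {d u v x y} (w : Walk G u v) → walkLength G w < d → u ~ x → v ~ y →
                    colour v y ≤ colour u x + d * n
      colour-span w w<d u~x v~y =
        ≤-trans (colour-walk w u~x v~y) (+-monoʳ-≤ _ (*-monoˡ-≤ n w<d))

      -- The two ends of the edge coloured t lie on different sides, so walks to them
      -- from one vertex have different lengths; one of them is shorter than d.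
      colouring-span : ∀ {d} → Bipartite G → (∀ u v → ∃[ w ] walkLength G {u} {v} w ≤ d) →
                       t ≤ suc (d * n)
      colouring-span {d} bip@(_ , alt) walks
        with all-used 1 ≤-refl positive | all-used t positive ≤-refl
      ... | u , x , u~x , c≡1 | v , y , v~y , c≡t
        with walks u v | walks u y
      ... | p , p≤d | q , q≤d with walkLength G p <? d
      ...   | yes p<d =
        subst₂ (λ c c′ → c ≤ c′ + d * n) c≡t c≡1 (colour-span p p<d u~x v~y)
      ...   | no  p≮d =
        subst₂ (λ c c′ → c ≤ c′ + d * n) (trans (sym (colour-sym v~y)) c≡t) c≡1
          (colour-span q (≤∧≢⇒< q≤d q≢d) u~x (~-sym v~y))
        where
        q≢d : walkLength G q ≢ d
        q≢d q≡d = alt v~y (trans (walk-side bip p)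
          (trans (cong (iterate not _) (trans (≤-antisym p≤d (≮⇒≥ p≮d)) (sym q≡d)))
            (sym (walk-side bip q))))

-- Joining positions by reflecting clipped intervals.

module _ (n M : ℕ) where

  -- The ends of the interval reflected by colour `c`: truncated subtraction clips it at 0 and `_⊓_`
  -- clips it at `M`.
  low high : ℕ → ℕ
  low  c = c ∸ n
  high c = c ⊓ M

  Joins : ℕ → ℕ → ℕ → Set
  Joins c i j = low c ≤ i × i ≤ high c × i + j ≡ low c + high c

  Adjacent : ℕ → ℕ → Set
  Adjacent i j = ∃[ c ] Joins c i j

  -- Reflection exchanges the two bounds: since `i + j` is the sum of the ends, `i ≤ high c` gives
  -- `low c ≤ j`, and `low c ≤ i` gives `j ≤ high c`.
  joins-sym : ∀ {c i j} → Joins c i j → Joins c j i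
  joins-sym {c} {i} {j} (l≤i , i≤h , eq) =
      +-cancelʳ-≤ (high c) _ _ (begin
        low c + high c  ≡⟨ eq ⟨
        i + j           ≤⟨ +-monoˡ-≤ j i≤h ⟩
        high c + j      ≡⟨ +-comm (high c) j ⟩
        j + high c      ∎)
    , +-cancelˡ-≤ (low c) _ _ (begin
        low c + j       ≤⟨ +-monoˡ-≤ j l≤i ⟩
        i + j           ≡⟨ eq ⟩
        low c + high c  ∎)
    , trans (+-comm j i) eq
    where open ≤-Reasoning

  joins⇒≤M : ∀ {c i j} → Joins c i j → i ≤ M
  joins⇒≤M {c} (_ , i≤h , _) = ≤-trans i≤h (m⊓n≤n c M)

  joins⇒i≤c : ∀ {c i j} → Joins c i j → i ≤ c
  joins⇒i≤c {c} (_ , i≤h , _) = ≤-trans i≤h (m⊓n≤m c M)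

  joins⇒c≤i+n : ∀ {c i j} → Joins c i j → c ≤ i + n
  joins⇒c≤i+n {c} {i} (l≤i , _ , _) = begin
    c            ≤⟨ m≤n+m∸n c n ⟩
    n + low c    ≤⟨ +-monoʳ-≤ n l≤i ⟩
    n + i        ≡⟨ +-comm n i ⟩
    i + n        ∎
    where open ≤-Reasoning

  joins⇒j≤i+n : ∀ {c i j} → Joins c i j → j ≤ i + n
  joins⇒j≤i+n J = ≤-trans (joins⇒i≤c (joins-sym J)) (joins⇒c≤i+n J)

  join : ∀ {c i} → i ≤ M → i ≤ c → c ≤ i + n → ∃[ j ] Joins c i j
  join {c} {i} i≤M i≤c c≤i+n =
      low c + (high c ∸ i)
    , m≤n+o⇒m∸n≤o c n (≤-trans c≤i+n (≤-reflexive (+-comm i n)))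
    , i≤h
    , (begin
        i + (low c + (high c ∸ i))  ≡⟨ +-assoc i (low c) _ ⟨
        i + low c + (high c ∸ i)    ≡⟨ cong (_+ (high c ∸ i)) (+-comm i (low c)) ⟩
        low c + i + (high c ∸ i)    ≡⟨ +-assoc (low c) i _ ⟩
        low c + (i + (high c ∸ i))  ≡⟨ cong (low c +_) (m+[n∸m]≡n i≤h) ⟩
        low c + high c              ∎)
    where
    open ≡-Reasoning
    i≤h : i ≤ high c
    i≤h = ⊓-glb i≤c i≤M

  -- A colour that joins `i` to anything is at most `i + n`, so a bounded search decides.
  adjacent? : ∀ i j → Dec (Adjacent i j)
  adjacent? i j = map′
    (λ (c , _ , J) → c , J)
    (λ (c , J) → c , s≤s (joins⇒c≤i+n J) , J)
    (anyUpTo? (λ c → low c ≤? i ×-dec i ≤? high c ×-dec i + j ≟ low c + high c) (suc (i + n)))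

  -- Below `M` the upper end moves strictly. From `M` on the lower end does, because `n ≤ M` keeps
  -- the subtraction from truncating. Hence the sum `i + j` determines the colour.
  low+high-mono-< : n ≤ M → ∀ {c c′} → c < c′ → low c + high c < low c′ + high c′
  low+high-mono-< n≤M {c} {c′} c<c′ with c <? M
  ... | yes c<M = +-mono-≤-< (∸-monoˡ-≤ n (<⇒≤ c<c′))
    (≤-trans (s≤s (m⊓n≤m c M)) (⊓-glb c<c′ c<M))
  ... | no  c≮M = +-mono-<-≤ (∸-monoˡ-< c<c′ (≤-trans n≤M (≮⇒≥ c≮M)))
    (⊓-monoˡ-≤ M (<⇒≤ c<c′))

  joins-unique : n ≤ M → ∀ {c c′ i j} → Joins c i j → Joins c′ i j → c ≡ c′
  joins-unique n≤M {c} {c′} (_ , _ , eq) (_ , _ , eq′) with <-cmp c c′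
  ... | tri< c<c′ _ _ = contradiction (trans (sym eq) eq′) (<⇒≢ (low+high-mono-< n≤M c<c′))
  ... | tri≈ _ c≡c′ _ = c≡c′
  ... | tri> _ _ c′<c = contradiction (trans (sym eq′) eq) (<⇒≢ (low+high-mono-< n≤M c′<c))

-- Walks of unit steps.

-- Unit steps on the cycle formed by two copies of the path 0 … M joined at both ends;
-- the copy is not recorded, as each step changes it.
module _ {M : ℕ} where

  infixr 5 _◅_

  data Step : ℕ → ℕ → Set where
    up     : ∀ {i} → i < M → Step i (suc i)
    down   : ∀ {i} → i < M → Step (suc i) i
    bottom : Step 0 0
    top    : Step M M

  data Steps : ℕ → ℕ → ℕ → Set where
    ε   : ∀ {i} → Steps 0 i i
    _◅_ : ∀ {m i j k} → Step i j → Steps m j k → Steps (suc m) i k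

  step-sym : ∀ {i j} → Step i j → Step j i
  step-sym (up i<M)   = down i<M
  step-sym (down i<M) = up i<M
  step-sym bottom     = bottom
  step-sym top        = top

  step⇒≤M : ∀ {i j} → Step i j → j ≤ M
  step⇒≤M (up i<M)   = i<M
  step⇒≤M (down i<M) = <⇒≤ i<M
  step⇒≤M bottom     = z≤n
  step⇒≤M top        = ≤-refl

  steps⇒≤M : ∀ {m i j} → i ≤ M → Steps m i j → j ≤ M
  steps⇒≤M i≤M ε       = i≤M
  steps⇒≤M i≤M (s ◅ ss) = steps⇒≤M (step⇒≤M s) ss

  steps₀⇒≡ : ∀ {i j} → Steps 0 i j → i ≡ j
  steps₀⇒≡ ε = refl

  infixr 5 _◅◅_
  _◅◅_ : ∀ {l m i j k} → Steps l i j → Steps m j k → Steps (l + m) i k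
  ε       ◅◅ ts = ts
  (s ◅ ss) ◅◅ ts = s ◅ (ss ◅◅ ts)

  steps-split : ∀ l {m i k} → Steps (l + m) i k → ∃[ j ] (Steps l i j × Steps m j k)
  steps-split zero    ss       = _ , ε , ss
  steps-split (suc l) (s ◅ ss) with steps-split l ss
  ... | j , ts , us = j , s ◅ ts , us

  steps-sym : ∀ {m i j} → Steps m i j → Steps m j i
  steps-sym                ε       = ε
  steps-sym {suc m} {i} {j} (s ◅ ss) =
    subst (λ l → Steps l j i) (+-comm m 1) (steps-sym ss ◅◅ step-sym s ◅ ε)

  climb : ∀ m {i} → m + i ≤ M → Steps m i (m + i)
  climb zero    _     = ε
  climb (suc m) {i} m+i<M =
    subst (λ l → Steps l i (suc m + i)) (+-comm m 1) (climb m (<⇒≤ m+i<M) ◅◅ up m+i<M ◅ ε)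

  climb-to : ∀ {m i j} → j ≤ M → m + i ≡ j → Steps m i j
  climb-to {m} j≤M refl = climb m j≤M

  pad : ∀ r {m i j} → i ≤ M → Steps m i j → Steps (r * 2 + m) i j
  pad zero    i≤M ss = ss
  pad (suc r) {i = zero}  i≤M ss = bottom ◅ bottom ◅ pad r i≤M ss
  pad (suc r) {i = suc i} i≤M ss = down i≤M ◅ up i≤M ◅ pad r i≤M ss

  even⊎odd : ∀ m → ∃[ r ] (m ≡ r * 2 ⊎ m ≡ suc (r * 2))
  even⊎odd zero    = 0 , inj₁ refl
  even⊎odd (suc m) with even⊎odd m
  ... | r , inj₁ eq = r , inj₂ (cong suc eq)
  ... | r , inj₂ eq = suc r , inj₁ (cong suc eq)

  -- If `M` and `j - i` have equal parity, the direct climb is padded. Otherwise the walk turns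
  -- once: at 0 this takes `i + j + 1` steps, at `M` it takes `2 M - i - j + 1`. Both numbers have
  -- the parity of `M` and they add up to `2 M + 2`, so the smaller is at most `M` and can be
  -- padded.
  M-steps-up : ∀ {i j} → i ≤ j → j ≤ M → Steps M i j
  M-steps-up {i} {j} i≤j j≤M
    with m≤n⇒∃[o]m+o≡n i≤j | m≤n⇒∃[o]m+o≡n j≤M
  ... | e , refl | b , i+e+b≡M
    with m≤n⇒∃[o]m+o≡n (≤-trans (m≤n+m e i) j≤M)
  ... | rest , e+rest≡M with even⊎odd rest
  ...   | r , inj₁ refl =
    subst (λ l → Steps l i (i + e)) (trans (+-comm (r * 2) e) e+rest≡M)
      (pad r (≤-trans i≤j j≤M) (climb-to j≤M (+-comm e i)))
  -- Here `M` is `e + 1 + 2 r`, and turning at 0 takes `e + 1 + 2 i` steps, so it fits exactly when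
  -- `i ≤ r`.
  ...   | r , inj₂ refl with ≤-<-connex i r
  ...     | inj₁ i≤r with m≤n⇒∃[o]m+o≡n i≤r
  ...       | x , refl =
    subst (λ l → Steps l i (i + e)) len
      (pad x (≤-trans i≤j j≤M)
        (steps-sym (climb-to (≤-trans i≤j j≤M) (+-identityʳ i))
          ◅◅ bottom ◅ climb-to j≤M (+-identityʳ (i + e))))
    where
    len : x * 2 + (i + suc (i + e)) ≡ M
    len = begin
      x * 2 + (i + suc (i + e))  ≡⟨ solve (x ∷ i ∷ e ∷ []) ⟩
      e + suc ((i + x) * 2)      ≡⟨ e+rest≡M ⟩
      M                          ∎
      where open ≡-Reasoning
  M-steps-up {i} i≤j j≤M | e , refl | b , i+e+b≡M | _ , e+rest≡M | r , inj₂ refl | inj₂ r<i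
    with m≤n⇒∃[o]m+o≡n r<i
  ...       | x , refl =
    subst (λ l → Steps l i (i + e)) len
      (pad x (≤-trans i≤j j≤M)
        (climb-to {m = e + b} ≤-refl up-len
          ◅◅ top ◅ steps-sym (climb-to {m = b} ≤-refl (trans (+-comm b (i + e)) i+e+b≡M))))
    where
    open ≡-Reasoning
    up-len : e + b + (suc r + x) ≡ M
    up-len = begin
      e + b + (suc r + x)    ≡⟨ solve (r ∷ x ∷ e ∷ b ∷ []) ⟩
      suc r + x + e + b      ≡⟨ i+e+b≡M ⟩
      M                      ∎
    len : x * 2 + (e + b + suc b) ≡ M
    -- Adding `M` allows both of its expressions to be used: once `e + 1 + 2 r` on the left, twice
    -- `i + e + b` on the right.
    len = +-cancelˡ-≡ M _ _ (begin
      M + (x * 2 + (e + b + suc b))                   ≡⟨ cong (_+ (x * 2 + (e + b + suc b))) e+rest≡M ⟨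
      e + suc (r * 2) + (x * 2 + (e + b + suc b))     ≡⟨ solve (r ∷ x ∷ e ∷ b ∷ []) ⟩
      (suc r + x + e + b) + (suc r + x + e + b)       ≡⟨ cong₂ _+_ i+e+b≡M i+e+b≡M ⟩
      M + M                                           ∎)

  M-steps : ∀ {i j} → i ≤ M → j ≤ M → Steps M i j
  M-steps {i} {j} i≤M j≤M with ≤-total i j
  ... | inj₁ i≤j = M-steps-up i≤j j≤M
  ... | inj₂ j≤i = steps-sym (M-steps-up j≤i i≤M)

  -- From unit steps back to edges.

  -- The three cases are walks turning at 0, turning at M, and not turning.  The parity
  -- condition is lost in the first two because it is not preserved by a turn.
  Near : ℕ → ℕ → ℕ → Set
  Near n i j = i + j ≤ n
             ⊎ M + M ≤ i + j + n
             ⊎ i ≤ j + n × j ≤ i + n × ∃[ c ] c * 2 ≡ i + j + n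

  -- `up` and `down` keep the case, and so does a turn put before a walk that turns already. Put
  -- before a straight walk, `bottom` leads to the first case and `top` to the second.
  near-step : ∀ {n i j k} → Step i j → Near n j k → Near (suc n) i k
  near-step {n} {i} {k = k} (up _) (inj₁ le) = inj₁ (≤-trans (n≤1+n _) (m≤n⇒m≤1+n le))
  near-step {n} {i} {k = k} (up _) (inj₂ (inj₁ le)) =
    inj₂ (inj₁ (≤-trans le (≤-reflexive (sym (+-suc (i + k) n)))))
  near-step {n} {i} {k = k} (up _) (inj₂ (inj₂ (p , q , c , eq))) =
    inj₂ (inj₂ (≤-trans (n≤1+n i) (≤-trans p (+-monoʳ-≤ k (n≤1+n n)))
      , ≤-trans q (≤-reflexive (sym (+-suc i n)))
      , c , trans eq (sym (+-suc (i + k) n))))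
  near-step (down _) (inj₁ le) = inj₁ (s≤s le)
  near-step {n} {j = j} {k} (down _) (inj₂ (inj₁ le)) =
    inj₂ (inj₁ (≤-trans le (m≤n⇒m≤1+n (+-monoʳ-≤ (j + k) (n≤1+n n)))))
  near-step {n} {j = j} {k} (down _) (inj₂ (inj₂ (p , q , c , eq))) =
    inj₂ (inj₂ (≤-trans (s≤s p) (≤-reflexive (sym (+-suc k n)))
      , ≤-trans q (m≤n⇒m≤1+n (+-monoʳ-≤ j (n≤1+n n)))
      , suc c , trans (cong (2 +_) eq) (cong suc (sym (+-suc (j + k) n)))))
  near-step bottom (inj₁ le) = inj₁ (m≤n⇒m≤1+n le)
  near-step {n} {k = k} bottom (inj₂ (inj₁ le)) =
    inj₂ (inj₁ (≤-trans le (+-monoʳ-≤ k (n≤1+n n))))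
  near-step bottom (inj₂ (inj₂ (_ , k≤n , _))) = inj₁ (m≤n⇒m≤1+n k≤n)
  near-step top (inj₁ le) = inj₁ (m≤n⇒m≤1+n le)
  near-step {n} {k = k} top (inj₂ (inj₁ le)) =
    inj₂ (inj₁ (≤-trans le (+-monoʳ-≤ (M + k) (n≤1+n n))))
  near-step {n} {k = k} top (inj₂ (inj₂ (M≤k+n , _))) =
    inj₂ (inj₁ (≤-trans (+-monoʳ-≤ M (≤-trans M≤k+n (+-monoʳ-≤ k (n≤1+n n))))
      (≤-reflexive (sym (+-assoc M k (suc n))))))

  steps⇒near : ∀ {n i j} → Steps n i j → Near n i j
  steps⇒near {i = i} ε =
    inj₂ (inj₂ (m≤m+n i 0 , m≤m+n i 0 , i , solve (i ∷ [])))
  steps⇒near (s ◅ ss) = near-step s (steps⇒near ss)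

-- The colour solves `low c + high c ≡ i + j`. For an interval clipped only at 0 it is `i + j`, for
-- one clipped only at `M` it is `i + j + n - M`, and for an unclipped one it is half of
-- `i + j + n`, which is where the parity condition enters.
near⇒adjacent : ∀ {n M i j} → n ≤ M → i ≤ M → j ≤ M → Near {M} n i j → Adjacent n M i j
near⇒adjacent {n} {M} {i} {j} n≤M i≤M j≤M (inj₁ i+j≤n) =
    i + j
  , m≤n+o⇒m∸n≤o (i + j) n (≤-trans i+j≤n (m≤m+n n i))
  , ⊓-glb (m≤m+n i j) i≤M
  , sym (cong₂ _+_ (m≤n⇒m∸n≡0 i+j≤n) (m≤n⇒m⊓n≡m (≤-trans i+j≤n n≤M)))
near⇒adjacent {n} {M} {i} {j} n≤M i≤M j≤M (inj₂ (inj₁ le)) with m≤n⇒∃[o]m+o≡n le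
... | e , eq =
    M + e
  , m≤n+o⇒m∸n≤o (M + e) n (+-cancelˡ-≤ M _ _ (begin
      M + (M + e)  ≡⟨ trans (sym (+-assoc M M e)) eq ⟩
      i + j + n    ≤⟨ +-monoˡ-≤ n (+-monoʳ-≤ i j≤M) ⟩
      i + M + n    ≡⟨ solve (i ∷ M ∷ n ∷ []) ⟩
      M + (n + i)  ∎))
  , ⊓-glb (≤-trans i≤M (m≤m+n M e)) i≤M
  , +-cancelʳ-≡ n _ _ (begin-equality
      i + j + n                             ≡⟨ trans (sym eq) (+-assoc M M e) ⟩
      M + (M + e)                           ≡⟨ cong (M +_) (m∸n+n≡m (≤-trans n≤M (m≤m+n M e))) ⟨
      M + (M + e ∸ n + n)                   ≡⟨ +-assoc M (M + e ∸ n) n ⟨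
      M + (M + e ∸ n) + n                   ≡⟨ cong (_+ n) (+-comm M (M + e ∸ n)) ⟩
      (M + e ∸ n) + M + n                   ≡⟨ cong (λ h → (M + e ∸ n) + h + n) (m≥n⇒m⊓n≡n (m≤m+n M e)) ⟨
      (M + e ∸ n) + (M + e) ⊓ M + n         ∎)
  where open ≤-Reasoning
near⇒adjacent {n} {M} {i} {j} n≤M i≤M j≤M (inj₂ (inj₂ (i≤j+n , j≤i+n , c , eq)))
  -- Half of `i + j + n` is the right colour only between `n` and `M`; outside this range the
  -- interval is clipped and an earlier case applies.
  with ≤-total (i + j) n | ≤-total (M + M) (i + j + n)
... | inj₁ i+j≤n | _ = near⇒adjacent n≤M i≤M j≤M (inj₁ i+j≤n)
... | inj₂ _ | inj₁ M+M≤ = near⇒adjacent n≤M i≤M j≤M (inj₂ (inj₁ M+M≤))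
... | inj₂ n≤i+j | inj₂ ≤M+M =
    c
  , m≤n+o⇒m∸n≤o c n (*-cancelʳ-≤ c (n + i) 2 (begin
      c * 2            ≡⟨ eq ⟩
      i + j + n        ≤⟨ +-monoˡ-≤ n (+-monoʳ-≤ i j≤i+n) ⟩
      i + (i + n) + n  ≡⟨ solve (i ∷ n ∷ []) ⟩
      (n + i) * 2      ∎))
  , ⊓-glb (*-cancelʳ-≤ i c 2 (begin
      i * 2        ≡⟨ solve (i ∷ []) ⟩
      i + i        ≤⟨ +-monoʳ-≤ i i≤j+n ⟩
      i + (j + n)  ≡⟨ trans (sym (+-assoc i j n)) (sym eq) ⟩
      c * 2        ∎)) i≤M
  , +-cancelʳ-≡ n _ _ (begin-equality
      i + j + n          ≡⟨ eq ⟨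
      c * 2              ≡⟨ solve (c ∷ []) ⟩
      c + c              ≡⟨ cong (_+ c) (m∸n+n≡m n≤c) ⟨
      c ∸ n + n + c      ≡⟨ xy∙z≈xz∙y (c ∸ n) n c ⟩
      c ∸ n + c + n      ≡⟨ cong (λ h → c ∸ n + h + n) (m≤n⇒m⊓n≡m c≤M) ⟨
      c ∸ n + c ⊓ M + n  ∎)
  where
  open ≤-Reasoning
  n≤c : n ≤ c
  n≤c = *-cancelʳ-≤ n c 2 (begin
    n * 2      ≡⟨ solve (n ∷ []) ⟩
    n + n      ≤⟨ +-monoˡ-≤ n n≤i+j ⟩
    i + j + n  ≡⟨ eq ⟨
    c * 2      ∎)
  c≤M : c ≤ M
  c≤M = *-cancelʳ-≤ c M 2 (begin
    c * 2      ≡⟨ eq ⟩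
    i + j + n  ≤⟨ ≤M+M ⟩
    M + M      ≡⟨ solve (M ∷ []) ⟩
    M * 2      ∎)

-- The graph and its walks.

module _ (n k : ℕ) (n≤k*n : n ≤ k * n) where

  private
    M L : ℕ
    M = k * n
    L = suc M
    V : Set
    V = Fin (2 * L)

  side : V → Bool
  side v = Inverse.to 2↔Bool (proj₁ (remQuot {2} L v))

  position : V → ℕ
  position v = toℕ (proj₂ (remQuot {2} L v))

  vertex : ∀ (b : Bool) {i} → i ≤ M → V
  vertex b i≤M = combine (Inverse.from 2↔Bool b) (fromℕ< (s≤s i≤M))

  side-vertex : ∀ b {i} (i≤M : i ≤ M) → side (vertex b i≤M) ≡ b
  side-vertex b i≤M = trans
    (cong (Inverse.to 2↔Bool ∘ proj₁) (remQuot-combine (Inverse.from 2↔Bool b) (fromℕ< (s≤s i≤M))))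
    (Inverse.strictlyInverseˡ 2↔Bool b)

  position-vertex : ∀ b {i} (i≤M : i ≤ M) → position (vertex b i≤M) ≡ i
  position-vertex b i≤M = trans
    (cong (toℕ ∘ proj₂) (remQuot-combine (Inverse.from 2↔Bool b) (fromℕ< (s≤s i≤M))))
    (toℕ-fromℕ< (s≤s i≤M))

  position≤M : ∀ v → position v ≤ M
  position≤M v = toℕ≤pred[n] (proj₂ (remQuot {2} L v))

  vertex-ext : ∀ {u v} → side u ≡ side v → position u ≡ position v → u ≡ v
  vertex-ext {u} {v} s≡ p≡ = begin
    u                                        ≡⟨ combine-remQuot {2} L u ⟨
    uncurry combine (remQuot {2} L u)        ≡⟨ cong (uncurry combine) rq≡ ⟩
    uncurry combine (remQuot {2} L v)        ≡⟨ combine-remQuot {2} L v ⟩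
    v                                        ∎
    where
    open ≡-Reasoning
    rq≡ : remQuot {2} L u ≡ remQuot {2} L v
    rq≡ = cong₂ _,_ (Injection.injective (↔⇒↣ 2↔Bool) s≡) (toℕ-injective p≡)

  -- A record, unlike a product, lets `u` and `v` be inferred from an edge; their sides and
  -- positions would not determine them for unification.
  record Edge (u v : V) : Set where
    constructor edge
    field
      opposite : side u ≢ side v
      adjacent : Adjacent n M (position u) (position v)

  open Edge

  graph : Graph
  graph = record
    { order    = 2 * L
    ; _~_      = Edge
    ; _~?_     = λ u v → map′ (λ (s≢ , a) → edge s≢ a) (λ e → opposite e , adjacent e)
                   (¬? (side u ≟ᵇ side v) ×-dec adjacent? n M (position u) (position v))
    ; ~-sym    = λ (edge s≢ (c , J)) → edge (s≢ ∘ sym) (c , joins-sym n M J)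
    ; ~-irrefl = λ { refl (edge s≢ _) → s≢ refl }
    }

  open Graph graph using (_~_; _~?_; ~-sym)

  bipartite : Bipartite graph
  bipartite = side , opposite

  adjacent⇒~ : ∀ {u} {c j} (J : Joins n M c (position u) j) →
               ∃[ v ] (u ~ v × Joins n M c (position u) (position v) × position v ≡ j)
  adjacent⇒~ {u} {c} {j} J =
      v
    , edge (λ eq → not-¬ refl (trans eq (side-vertex (not (side u)) j≤M))) (c , J′)
    , J′
    , position-vertex (not (side u)) j≤M
    where
    j≤M : j ≤ M
    j≤M = joins⇒≤M n M (joins-sym n M J)
    v : V
    v = vertex (not (side u)) j≤M
    J′ : Joins n M c (position u) (position v)
    J′ = subst (Joins n M c (position u)) (sym (position-vertex (not (side u)) j≤M)) J

  -- Each block of `n` unit steps becomes one edge. Only positions carry over: an edge changes the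
  -- side once, whatever its unit steps do, so the side of the end needs its own hypothesis.
  steps⇒walk : ∀ m {u v} → Steps {M} (m * n) (position u) (position v) →
               side v ≡ iterate not (side u) m → ∃[ w ] walkLength graph {u} {v} w ≡ m
  steps⇒walk zero ss s≡ = ≡⇒walk graph (vertex-ext (sym s≡) (steps₀⇒≡ ss))
  steps⇒walk (suc m) {u} {v} ss s≡ with steps-split n ss
  ... | j , ss₁ , ss₂
    with near⇒adjacent n≤k*n (position≤M u) (steps⇒≤M (position≤M u) ss₁) (steps⇒near ss₁)
  ... | c , J with adjacent⇒~ {u} J
  ... | x , u~x , _ , refl
    with steps⇒walk m ss₂ (trans s≡ (cong (λ s → iterate not s m) (sym (¬-not (opposite u~x ∘ sym)))))
  ... | w , len = u~x ◅ w , cong suc len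

  -- The `M` unit steps between any two positions make `k` edges. If `v` is on the wrong side for a
  -- walk of length `k`, one preliminary edge corrects the parity.
  walk≤ : ∀ u v → ∃[ w ] walkLength graph {u} {v} w ≤ suc k
  walk≤ u v with side v ≟ᵇ iterate not (side u) k
  ... | yes s≡ with steps⇒walk k {u} {v} (M-steps (position≤M u) (position≤M v)) s≡
  ...   | w , len = w , ≤-trans (≤-reflexive len) (n≤1+n k)
  walk≤ u v | no s≢
    -- Any neighbour of `u` will do; this one is reached by the least colour at `u`, namely
    -- `position u`.
    with adjacent⇒~ {u} (proj₂ (join n M {position u} (position≤M u) ≤-refl (m≤m+n _ n)))
  ... | x , u~x , _
    with steps⇒walk k {x} {v} (M-steps (position≤M x) (position≤M v))
           (trans (¬-not s≢) (trans (sym (iterate-not-suc k (side u)))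
             (cong (λ s → iterate not s k) (sym (¬-not (opposite u~x ∘ sym))))))
  ... | w , len = u~x ◅ w , s≤s (≤-reflexive len)

  -- The diameter.

  walk-position : ∀ {u v} (w : Walk graph u v) → position v ≤ position u + walkLength graph w * n
  walk-position ε = m≤m+n _ 0
  walk-position {u} {v} (_◅_ {j = x} (edge _ (_ , J)) w) = begin
    position v               ≤⟨ walk-position w ⟩
    position x + ℓ * n       ≤⟨ +-monoˡ-≤ (ℓ * n) (joins⇒j≤i+n n M J) ⟩
    position u + n + ℓ * n   ≡⟨ +-assoc (position u) n (ℓ * n) ⟩
    position u + (n + ℓ * n) ∎
    where open ≤-Reasoning; ℓ = walkLength graph w

  diameter : 0 < n → Diameter graph (suc k)
  diameter 0<n = (u , v , far) , λ { m (x , y , (_ , least)) →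
      ≤-trans (least _ (proj₁ (walk≤ x y) , refl)) (proj₂ (walk≤ x y)) }
    where
    instance
      n≢0 : NonZero n
      n≢0 = >-nonZero 0<n
    u v : V
    u = vertex false z≤n
    -- Position `M` forces at least `k` edges, and the side, chosen by the parity of `k + 1`,
    -- excludes exactly `k`.
    v = vertex (iterate not false (suc k)) ≤-refl
    ≥k : (w : Walk graph u v) → k ≤ walkLength graph w
    ≥k w = *-cancelʳ-≤ k _ n (subst₂ (λ p q → p ≤ q + walkLength graph w * n)
      (position-vertex (iterate not false (suc k)) ≤-refl) (position-vertex false z≤n) (walk-position w))
    ≢k : (w : Walk graph u v) → walkLength graph w ≢ k
    ≢k w w≡k = not-¬
      (trans (walk-side graph bipartite w) (cong₂ (iterate not) (side-vertex false z≤n) w≡k))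
      (trans (side-vertex _ ≤-refl) (iterate-not-suc k false))
    >k : (w : Walk graph u v) → suc k ≤ walkLength graph w
    >k w = ≤∧≢⇒< (≥k w) (≢k w ∘ sym)
    far : Distance graph u v (suc k)
    far = (proj₁ (walk≤ u v) , ≤-antisym (proj₂ (walk≤ u v)) (>k _))
        , λ { _ (w , refl) → >k w }

  -- The colouring and the degrees.

  -- The shift by `suc` makes colours start at 1; 0 is a filler for pairs that are not adjacent.
  colourOf : ∀ {u v} → Dec (u ~ v) → ℕ
  colourOf (yes (edge _ (c , _))) = suc c
  colourOf (no  _)           = 0

  -- The colour stored in the decision need not be the given one definitionally; `joins-unique`
  -- identifies the two.
  colourOf≡ : ∀ {u v c} (a? : Dec (u ~ v)) → u ~ v → Joins n M c (position u) (position v) →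
              colourOf a? ≡ suc c
  colourOf≡ (yes (edge _ (_ , J′))) _   J = cong suc (joins-unique n M n≤k*n J′ J)
  colourOf≡ (no  u≁v)          u~v J = contradiction u~v u≁v

  colour : V → V → ℕ
  colour u v = colourOf (u ~? v)

  colour≡ : ∀ {u v c} → u ~ v → Joins n M c (position u) (position v) → colour u v ≡ suc c
  colour≡ {u} {v} = colourOf≡ (u ~? v)

  coloured-neighbour : ∀ {u c} → position u ≤ c → c ≤ position u + n → ∃[ v ] (u ~ v × colour u v ≡ suc c)
  coloured-neighbour {u} p≤c c≤p+n with adjacent⇒~ {u} (proj₂ (join n M (position≤M u) p≤c c≤p+n))
  ... | v , u~v , J , _ = v , u~v , colour≡ u~v J

  -- A colour is a single reflection, so it fixes the position of the other end, and the side is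
  -- opposite to that of `u`. This yields properness and half of the degree count.
  same-colour : ∀ {u v w} → u ~ v → u ~ w → colour u v ≡ colour u w → v ≡ w
  same-colour {u} {v} {w} u~v@(edge s≢ (c , J)) u~w@(edge s≢′ (c′ , J′)) eq = vertex-ext
    (trans (¬-not (s≢ ∘ sym)) (sym (¬-not (s≢′ ∘ sym))))
    (+-cancelˡ-≡ (position u) _ _ (begin
      position u + position v    ≡⟨ proj₂ (proj₂ J) ⟩
      low n M c + high n M c     ≡⟨ cong (λ c → low n M c + high n M c) c≡c′ ⟩
      low n M c′ + high n M c′   ≡⟨ proj₂ (proj₂ J′) ⟨
      position u + position w    ∎))
    where
    open ≡-Reasoning
    c≡c′ : c ≡ c′
    c≡c′ = suc-injective (trans (sym (colour≡ u~v J)) (trans eq (colour≡ u~w J′)))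

  colour-bounds : ∀ {u v} → u ~ v → suc (position u) ≤ colour u v × colour u v ≤ suc (position u + n)
  colour-bounds {u} u~v@(edge _ (c , J)) = subst (λ x → suc (position u) ≤ x × x ≤ suc (position u + n))
    (sym (colour≡ u~v J)) (s≤s (joins⇒i≤c n M J) , s≤s (joins⇒c≤i+n n M J))

  colouring : IntervalColoring graph (suc (suc k * n))
  colouring = record
    { positive   = z<s
    ; colour     = colour
    ; colour-sym = λ { u~v@(edge _ (c , J)) → trans (colour≡ u~v J) (sym (colour≡ (~-sym u~v) (joins-sym n M J))) }
    ; colour-≥1  = λ u~v → ≤-trans (s≤s z≤n) (proj₁ (colour-bounds u~v))
    ; colour-≤t  = λ {u} u~v → ≤-trans (proj₂ (colour-bounds u~v))
                     (s≤s (≤-trans (+-monoˡ-≤ n (position≤M u)) (≤-reflexive (+-comm M n))))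
    ; all-used   = all-used
    ; proper     = λ u~v u~w v≢w → v≢w ∘ same-colour u~v u~w
    ; interval   = λ u → suc (position u) , suc (position u + n) , λ i → mk⇔
                     (λ { (v , u~v , refl) → colour-bounds u~v }) (spectrum u i)
    }
    where
    spectrum : ∀ u i → suc (position u) ≤ i × i ≤ suc (position u + n) → ∃[ v ] (u ~ v × colour u v ≡ i)
    spectrum u (suc c) (s≤s p≤c , s≤s c≤p+n) = coloured-neighbour p≤c c≤p+n
    all-used : ∀ i → 1 ≤ i → i ≤ suc (suc k * n) → ∃₂ λ u v → u ~ v × colour u v ≡ i
    -- `c ∸ n` is the lowest position that sees the 0-based colour `c`.
    all-used (suc c) _ (s≤s c≤) = vertex false l≤M , coloured-neighbour
      (subst (_≤ c) (sym (position-vertex false l≤M)) (m∸n≤m c n))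
      (subst (λ p → c ≤ p + n) (sym (position-vertex false l≤M))
        (≤-trans (m≤n+m∸n c n) (≤-reflexive (+-comm n (c ∸ n)))))
      where
      l≤M : c ∸ n ≤ M
      l≤M = m≤n+o⇒m∸n≤o c n c≤

  -- The offset of `colour u v` from the least colour at `u` matches the neighbours with the `n + 1`
  -- numbers up to `n`; each inequality uses one direction of this bijection.
  degree≡ : ∀ u → degree graph u ≡ suc n
  degree≡ u = ≤-antisym
    (injective⇒degree≤ graph (λ _ u~v → fromℕ< (offset<n u~v)) λ {v} {w} u~v u~w eq →
      same-colour u~v u~w (∸-cancelʳ-≡ (proj₁ (colour-bounds u~v)) (proj₁ (colour-bounds u~w))
        (fromℕ<-injective _ _ (offset<n u~v) (offset<n u~w) eq)))
    (injective⇒≤degree graph (proj₁ ∘ neighbour) (proj₁ ∘ proj₂ ∘ neighbour) λ {i} {j} eq →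
      toℕ-injective (+-cancelˡ-≡ (position u) _ _ (suc-injective
        (trans (sym (proj₂ (proj₂ (neighbour i))))
          (trans (cong (colour u) eq) (proj₂ (proj₂ (neighbour j))))))))
    where
    offset<n : ∀ {v} → u ~ v → colour u v ∸ suc (position u) < suc n
    offset<n u~v = s≤s (m≤n+o⇒m∸n≤o _ (suc (position u)) (proj₂ (colour-bounds u~v)))
    neighbour : ∀ (i : Fin (suc n)) → ∃[ v ] (u ~ v × colour u v ≡ suc (position u + toℕ i))
    neighbour i = coloured-neighbour (m≤m+n _ _) (+-monoʳ-≤ (position u) (toℕ≤pred[n] i))

  maxSpan : MaxIntervalSpan graph (suc (suc k * n))
  maxSpan = colouring , λ t C → colouring-span graph C (≤-reflexive ∘ degree≡) bipartite walk≤

theorem6 : ∀ (d Δ : ℕ) → d ≥ 2 → Δ ≥ 2 →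
    ∃[ G ] (Connected G × Bipartite G × Diameter G d × maxDegree G ≡ Δ
    × IntervalColorable G × MaxIntervalSpan G (d * (Δ ∸ 1) + 1))
theorem6 (suc k) (suc n) (s≤s 1≤k) (s≤s 1≤n) =
    graph n k n≤k*n
  , (λ u v → proj₁ (walk≤ n k n≤k*n u v))
  , bipartite n k n≤k*n
  , diameter n k n≤k*n 1≤n
  , regular⇒maxDegree (graph n k n≤k*n) (vertex n k n≤k*n false z≤n) (degree≡ n k n≤k*n)
  , (_ , colouring n k n≤k*n)
  , subst (MaxIntervalSpan (graph n k n≤k*n)) (sym (+-comm (suc k * n) 1)) (maxSpan n k n≤k*n)
  where
  -- As `d ≥ 2` makes `k` positive, the positions span at least the reach of one edge, as
  -- `joins-unique` and `near⇒adjacent` demand.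
  n≤k*n : n ≤ k * n
  n≤k*n = m≤n*m n k {{>-nonZero 1≤k}}
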